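{- Let $G$ be a connected unicyclic graph of order $n \ge 6$ whose complement $\overline{G}$ is connected. Then $Z(G)=n-3$ if and only if $G$ is the vertex sum of $C_3$ and the star $S_{n-2}$ at one of the leaves of the star, i.e., $G$ is obtained from a triangle $C_3$ and a star $S_{n-2}=K_{1,n-3}$ by identifying one vertex of the triangle with one leaf of the star.
   Context: A connected graph is unicyclic if it contains exactly one cycle. For a finite simple graph $G$, color a set $S\subseteq V(G)$ black and all other vertices white. The color-change rule: if a black vertex $u$ has exactly one white neighbor $w$, then $w$ is turned black. $S$ is a zero forcing set if repeated application of the rule eventually turns all vertices black; $Z(G)$ is the minimum size of a zero forcing set. $\overline{G}$ is the complement of $G$. $S_{n-2}=K_{1,n-3}$ is the star on $n-2$ vertices. -}

module Defs where

open import Data.Nat using (ℕ; zero; suc; _≤_; _%_)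
open import Data.Nat.DivMod using (m%n<n)
open import Data.Fin using (Fin; toℕ; fromℕ<; _≟_)
open import Data.Fin.Subset using (Subset; _∈_; ∣_∣)
open import Data.Bool using (Bool; true; false; not; _∧_; _∨_)
open import Data.Product using (Σ; ∃; ∃-syntax; _×_; _,_)
open import Data.Sum using (_⊎_)
open import Function.Bundles using (_↔_; Inverse)
open import Relation.Binary.PropositionalEquality using (_≡_)
open import Relation.Nullary using (¬_)
open import Relation.Nullary.Decidable using (⌊_⌋)

AdjRel : ℕ → Set
AdjRel n = Fin n → Fin n → Bool

record IsSimple {n : ℕ} (A : AdjRel n) : Set where
  field
    sym    : ∀ u v → A u v ≡ A v u
    irrefl : ∀ u → A u u ≡ false

Edge : ∀ {n} → AdjRel n → Fin n → Fin n → Set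
Edge A u v = A u v ≡ true

complement : ∀ {n} → AdjRel n → AdjRel n
complement A u v = not (A u v) ∧ not ⌊ u ≟ v ⌋

data Reach {n : ℕ} (A : AdjRel n) : Fin n → Fin n → Set where
  here : ∀ {u} → Reach A u u
  step : ∀ {u v w} → Edge A u v → Reach A v w → Reach A u w

Connected : ∀ {n} → AdjRel n → Set
Connected A = ∀ u v → Reach A u v

next : ∀ {m} → Fin (suc m) → Fin (suc m)
next {m} i = fromℕ< (m%n<n (suc (toℕ i)) (suc m))

record Cycle {n : ℕ} (A : AdjRel n) : Set where
  field
    m        : ℕ
    len≥3    : 2 ≤ m
    vertex   : Fin (suc m) → Fin n
    injective : ∀ i j → vertex i ≡ vertex j → i ≡ j
    adjacent : ∀ i → Edge A (vertex i) (vertex (next i))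

CycleEdge : ∀ {n} {A : AdjRel n} → Cycle A → Fin n → Fin n → Set
CycleEdge C u v =
  ∃[ i ] ((vertex i ≡ u × vertex (next i) ≡ v) ⊎ (vertex i ≡ v × vertex (next i) ≡ u))
  where open Cycle C

SameCycle : ∀ {n} {A : AdjRel n} → Cycle A → Cycle A → Set
SameCycle C D = ∀ u v → (CycleEdge C u v → CycleEdge D u v) × (CycleEdge D u v → CycleEdge C u v)

Unicyclic : ∀ {n} → AdjRel n → Set
Unicyclic A = Connected A × Σ (Cycle A) (λ C → ∀ D → SameCycle C D)

-- zero forcing: vertices that eventually become black from initial set S.
-- A black u all of whose neighbours other than w are black forces w.
data Forced {n : ℕ} (A : AdjRel n) (S : Subset n) : Fin n → Set where
  init  : ∀ {v} → v ∈ S → Forced A S v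
  force : ∀ {u w} → Forced A S u → Edge A u w →
          (∀ x → Edge A u x → ¬ x ≡ w → Forced A S x) → Forced A S w

IsZeroForcingSet : ∀ {n} → AdjRel n → Subset n → Set
IsZeroForcingSet A S = ∀ v → Forced A S v

ZeroForcingNumberIs : ∀ {n} → AdjRel n → ℕ → Set
ZeroForcingNumberIs {n} A k =
  (∃[ S ] (IsZeroForcingSet A S × ∣ S ∣ ≡ k)) ×
  (∀ (S : Subset n) → IsZeroForcingSet A S → k ≤ ∣ S ∣)

Isomorphic : ∀ {n} → AdjRel n → AdjRel n → Set
Isomorphic {n} A B =
  Σ (Fin n ↔ Fin n) (λ f → ∀ u v → B (Inverse.to f u) (Inverse.to f v) ≡ A u v)

-- Vertex sum of C_3 and the star S_{n-2} = K_{1,n-3} at a leaf of the star.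
-- Vertex 0: star centre; vertex 1: the identified vertex (star leaf = triangle vertex);
-- vertices 2,3: the other triangle vertices; vertices 4..n-1: the other n-4 star leaves.
triStarEdge : ℕ → ℕ → Bool
triStarEdge 0 1 = true
triStarEdge 0 (suc (suc (suc (suc _)))) = true
triStarEdge 1 2 = true
triStarEdge 1 3 = true
triStarEdge 2 3 = true
triStarEdge _ _ = false

triStar : (n : ℕ) → AdjRel n
triStar n u v = triStarEdge (toℕ u) (toℕ v) ∨ triStarEdge (toℕ v) (toℕ u)

{-# OPTIONS --safe #-}

-- Call pairs (u₁ , w₁), …, (uₘ , wₘ) a chain if uᵢ is adjacent to wᵢ but neither equal nor
-- adjacent to any later wⱼ. Starting from all vertices but the wᵢ, the pairs force in turn,
-- so Z(G) ≤ n ∸ m; hence Z(G) = n ∸ 3 excludes chains of length 4. In a unicyclic graph a new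
-- vertex attached to a connected induced subgraph containing the cycle has only one neighbour
-- there, since a second one would close a second cycle. A cycle of length at least 6 contains
-- an induced path on 5 vertices, hence a chain. Growing a shorter cycle vertex by vertex gives one of finitely many graphs on six vertices, and a search finds a chain of
-- length 4 in all of them except where a triangle carries a path a – x – y and every further
-- vertex is a leaf at x, or every vertex is a neighbour of a. Connectedness of the complement
-- rules out the latter, so G is the vertex sum. Conversely twins, and {1, 2 or 3, a leaf}, are
-- forts of the vertex sum: every zero forcing set meets them. Four white vertices always
-- include such a fort, so Z ≥ n ∸ 3, and a chain of length 3 gives equality.
module Submission where

open import Defs
open import Data.Bool using (Bool; true; false; T; _∨_)
import Data.Bool.Properties as Bool
open import Data.Empty using (⊥)
open import Data.Fin using (Fin; zero; suc; _≟_; toℕ; fromℕ; inject₁; splitAt; _↑ˡ_; _↑ʳ_; punchIn; punchOut)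
open import Data.Fin.Permutation as Perm using (Permutation′; _⟨$⟩ʳ_; _⟨$⟩ˡ_; insert; insert-punchIn; inverseʳ; flip)
open import Data.Fin.Properties using
  (any?; all?; 0≢1+n; suc-injective; toℕ-injective; toℕ-fromℕ<; toℕ-fromℕ; toℕ-inject₁; toℕ<n; injective⇒≤;
   punchOut-injective; punchIn-punchOut; splitAt⁻¹-↑ˡ; splitAt⁻¹-↑ʳ; splitAt-↑ˡ; splitAt-↑ʳ; toℕ-↑ˡ;
   ↑ˡ-injective; ↑ʳ-injective)
open import Data.Fin.Relation.Unary.Top using (view; ‵fromℕ; ‵inject₁)
open import Data.Fin.Subset using (Subset; inside; outside; ⊤; ∁; _∈_; _∉_; ∣_∣; _-_)
open import Data.Fin.Subset.Properties using (∈⊤; ∣⊤∣≡n; p─⊥≡p; x∈p∧x≢y⇒x∈p-y; ∣∁p∣≡n∸∣p∣; x∈∁p⇒x∉p)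
open import Data.List using (List; []; _∷_; length; map; foldr; lookup; allFin; cartesianProduct)
import Data.List.Membership.DecPropositional as DecMembership
open import Data.List.Membership.Propositional using () renaming (_∈_ to _∈ₗ_; _∉_ to _∉ₗ_)
open import Data.List.Membership.Propositional.Properties using (∈-lookup)
open import Data.List.Properties using (length-map)
open import Data.List.Relation.Unary.All as All using (All; []; _∷_)
import Data.List.Relation.Unary.All.Properties as All
open import Data.List.Relation.Unary.AllPairs as AllPairs using (AllPairs; []; _∷_)
import Data.List.Relation.Unary.AllPairs.Properties as AllPairs
open import Data.List.Relation.Unary.Any using (Any; here; there)
open import Data.List.Relation.Unary.Unique.Propositional using (Unique)
open import Data.Maybe using (Maybe; just; nothing; is-just; to-witness-T; _<∣>_)
open import Data.Nat using (ℕ; zero; suc; _+_; _∸_; _≤_; _<_; _≤?_; z≤n; s≤s; _%_)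
open import Data.Nat.DivMod using (m<n⇒m%n≡m; n%n≡0; m%n<n)
open import Data.Nat.Properties using
  (+-suc; +-identityʳ; +-cancelˡ-≡; ≤-trans; ≤-reflexive; ≤-pred; <⇒≱; <⇒≤; <⇒≢; ≰⇒>; n<1+n; n≤1+n; 1+n≰n;
   m≤m+n; m+n∸n≡m; ∸-monoʳ-≤)
open import Data.Product using (Σ; ∃-syntax; _×_; _,_; proj₁; proj₂; swap)
open import Data.Sum using (_⊎_; inj₁; inj₂; [_,_]; fromInj₂)
open import Data.Vec using (_∷_; here; there)
open import Data.Vec.Functional using () renaming (_∷_ to _◂_; [] to ◂[])
open import Function using (_∘_; Injection; Inverse; _↔_; _⇔_; mk⇔)
open import Function.Properties.Inverse using (↔⇒↣)
open import Relation.Binary.PropositionalEquality hiding ([_])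
open import Relation.Nullary using (¬_; Dec; yes; no; contradiction)
open import Relation.Nullary.Decidable using
  (⌊_⌋; ¬?; _×-dec_; _⊎-dec_; _→-dec_; map′; toWitness; dec-true; isYes≗does; decidable-stable)
open import Relation.Unary using (Decidable)

private variable
  k n : ℕ

-- Chains and zero forcing

Link : AdjRel n → Fin n × Fin n → Set
Link A (u , w) = Edge A u w

Independent : AdjRel n → Fin n × Fin n → Fin n × Fin n → Set
Independent A (u , _) (_ , w) = A u w ≡ false × u ≢ w

Chain : AdjRel n → List (Fin n × Fin n) → Set
Chain A ps = All (Link A) ps × AllPairs (Independent A) ps

HasChain : AdjRel n → ℕ → Set
HasChain A m = ∃[ ps ] (Chain A ps × length ps ≡ m)

¬edge : {b : Bool} → b ≡ true → b ≡ false → {X : Set} → X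
¬edge refl ()

blacks : List (Fin n × Fin n) → Subset n
blacks []             = ⊤
blacks ((_ , w) ∷ ps) = blacks ps - w

black∨forced : (ps : List (Fin n × Fin n)) (v : Fin n) →
               v ∈ blacks ps ⊎ Any (λ p → v ≡ proj₂ p) ps
black∨forced [] v = inj₁ ∈⊤
black∨forced ((_ , w) ∷ ps) v with v ≟ w | black∨forced ps v
... | yes v≡w | _       = inj₂ (here v≡w)
... | no v≢w  | inj₁ v∈ = inj₁ (x∈p∧x≢y⇒x∈p-y v∈ v≢w)
... | no v≢w  | inj₂ v∈ = inj₂ (there v∈)

∣p-x∣ : (p : Subset n) {x : Fin n} → x ∈ p → suc ∣ p - x ∣ ≡ ∣ p ∣
∣p-x∣ (_ ∷ p)       here       = cong (suc ∘ ∣_∣) (p─⊥≡p p)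
∣p-x∣ (outside ∷ p) (there x∈) = ∣p-x∣ p x∈
∣p-x∣ (inside ∷ p)  (there x∈) = cong suc (∣p-x∣ p x∈)

independent-of : ∀ (A : AdjRel n) p {ps v} → All (Independent A p) ps →
                 Any (λ q → v ≡ proj₂ q) ps → A (proj₁ p) v ≡ false × proj₁ p ≢ v
independent-of A p (indep ∷ _) (here refl) = indep
independent-of A p (_ ∷ indep) (there v∈)  = independent-of A p indep v∈

module _ (A : AdjRel n) (A-simple : IsSimple A) where

  -- Invariant: every vertex is already forced or is the target of a pair still to come.
  -- Independence keeps `u` and its neighbours other than `w` out of the later targets, so the first
  -- pair can force.
  chain-forces : ∀ {S} ps → Chain A ps →
                 (∀ v → Forced A S v ⊎ Any (λ p → v ≡ proj₂ p) ps) → IsZeroForcingSet A S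
  chain-forces [] _ start v with start v
  ... | inj₁ v-forced = v-forced
  chain-forces {S} ((u , w) ∷ ps) (uw ∷ links , u-indep ∷ indep) start =
    chain-forces ps (links , indep) start′
    where
    later : ∀ {v} → A u v ≡ true ⊎ v ≡ u → ¬ Any (λ p → v ≡ proj₂ p) ps
    later near v∈ with near | independent-of A (u , w) u-indep v∈
    ... | inj₁ uv   | u≁v , _   = ¬edge uv u≁v
    ... | inj₂ refl | _   , u≢u = u≢u refl

    forced : ∀ v → v ≢ w → A u v ≡ true ⊎ v ≡ u → Forced A S v
    forced v v≢w near with start v
    ... | inj₁ v-forced    = v-forced
    ... | inj₂ (here v≡w)  = contradiction v≡w v≢w
    ... | inj₂ (there v∈)  = contradiction v∈ (later near)

    w-forced : Forced A S w
    w-forced = force (forced u (λ { refl → ¬edge uw (IsSimple.irrefl A-simple u) }) (inj₂ refl)) uw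
                     (λ x ux x≢w → forced x x≢w (inj₁ ux))

    start′ : ∀ v → Forced A S v ⊎ Any (λ p → v ≡ proj₂ p) ps
    start′ v with start v
    ... | inj₁ v-forced    = inj₁ v-forced
    ... | inj₂ (here refl) = inj₁ w-forced
    ... | inj₂ (there v∈)  = inj₂ v∈

  ∣blacks∣ : ∀ ps → Chain A ps → length ps + ∣ blacks ps ∣ ≡ n
  ∣blacks∣ [] _ = ∣⊤∣≡n n
  ∣blacks∣ ((u , w) ∷ ps) (uw ∷ links , u-indep ∷ indep) with black∨forced ps w
  ... | inj₁ w∈ = trans (sym (+-suc (length ps) _))
                        (trans (cong (length ps +_) (∣p-x∣ (blacks ps) w∈)) (∣blacks∣ ps (links , indep)))
  -- Were `w` a later target, `u` would not be adjacent to it; so every removal takes away a vertex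
  -- still present.
  ... | inj₂ w∈ = ¬edge uw (proj₁ (independent-of A (u , w) u-indep w∈))

  chain⇒zeroForcing : ∀ {m} → HasChain A m → ∃[ S ] (IsZeroForcingSet A S × m + ∣ S ∣ ≡ n)
  chain⇒zeroForcing (ps , chain , refl) = blacks ps , chain-forces ps chain start , ∣blacks∣ ps chain
    where
    start : ∀ v → Forced A (blacks ps) v ⊎ Any (λ p → v ≡ proj₂ p) ps
    start v with black∨forced ps v
    ... | inj₁ v∈ = inj₁ (init v∈)
    ... | inj₂ v∈ = inj₂ v∈

record Induced (A : AdjRel n) (B : AdjRel k) (f : Fin k → Fin n) : Set where
  field
    injective : ∀ {i j} → f i ≡ f j → i ≡ j
    matches   : ∀ i j → A (f i) (f j) ≡ B i j

-- Being a chain depends only on adjacency and equality among the vertices used, and an induced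
-- embedding preserves both.
chain-map : ∀ {A : AdjRel n} {B : AdjRel k} {f m} → Induced A B f → HasChain B m → HasChain A m
chain-map {f = f} ind (ps , (links , indep) , len) =
  map f² ps ,
  (All.map⁺ (All.map (λ e → trans (matches _ _) e) links) ,
   AllPairs.map⁺ (AllPairs.map (λ (e , u≢w) → trans (matches _ _) e , u≢w ∘ injective) indep)) ,
  trans (length-map f² ps) len
  where
  open Induced ind
  f² : Fin _ × Fin _ → Fin _ × Fin _
  f² (u , w) = f u , f w

-- Searching a fixed graph for chains

module _ (B : AdjRel k) where

  independent? : ∀ p q → Dec (Independent B p q)
  independent? (u , _) (_ , w) = (B u w Bool.≟ false) ×-dec ¬? (u ≟ w)

  -- The chain grows from its last pair to its first, since a new first pair has to be compared only
  -- with those behind it.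
  searchFrom : ∀ m qs → Chain B qs → Maybe (HasChain B (m + length qs))
  searchFrom zero    qs chain = just (qs , chain , refl)
  searchFrom (suc m) qs (links , indep) =
    foldr (λ p rest → prepend p <∣> rest) nothing (cartesianProduct (allFin k) (allFin k))
    where
    prepend : Fin k × Fin k → Maybe (HasChain B (suc m + length qs))
    prepend p@(u , w) with B u w Bool.≟ true | All.all? (independent? p) qs
    ... | yes uw | yes p-indep = subst (Maybe ∘ HasChain B) (+-suc m (length qs))
                                   (searchFrom m (p ∷ qs) (uw ∷ links , p-indep ∷ indep))
    ... | _ | _ = nothing

  search : ∀ m → Maybe (HasChain B m)
  search m = subst (Maybe ∘ HasChain B) (+-identityʳ m) (searchFrom m [] ([] , []))

  -- A data type rather than a synonym, so that the search runs only where a Found is established.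
  data Found (m : ℕ) : Set where
    found : T (is-just (search m)) → Found m

-- The new vertex takes index `zero` and shifts the others, in step with the embedding `z ◂ f`.
addLeaf : AdjRel k → Fin k → AdjRel (suc k)
addLeaf B t zero    zero    = false
addLeaf B t zero    (suc j) = ⌊ t ≟ j ⌋
addLeaf B t (suc i) zero    = ⌊ t ≟ i ⌋
addLeaf B t (suc i) (suc j) = B i j

cyc : ∀ m → AdjRel (suc m)
cyc m i j = ⌊ next i ≟ j ⌋ ∨ ⌊ next j ≟ i ⌋

found? : ∀ (B : AdjRel k) m → Dec (Found B m)
found? B m = map′ found (λ { (found success) → success }) (Bool.T? (is-just (search B m)))

path : ∀ k → AdjRel (suc k)
path zero    = λ _ _ → false
path (suc k) = addLeaf (path k) zero

P₅-found : Found (path 4) 4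
P₅-found = found _

-- Six vertices are needed: on five, a chain of length 4 would let a single black vertex force
-- everything, which happens only in a path.
C₄-found : ∀ s t → Found (addLeaf (addLeaf (cyc 3) s) t) 4
C₄-found = toWitness {a? = all? λ s → all? λ t → found? _ 4} _

C₅-found : ∀ s → Found (addLeaf (cyc 4) s) 4
C₅-found = toWitness {a? = all? λ s → found? _ 4} _

-- The index `suc s` is the triangle vertex `s`, shifted by the first leaf; leaves at two corners
-- make a bull, and `r` carries a sixth vertex.
bull-found : ∀ t s r → s ≢ t → Found (addLeaf (addLeaf (addLeaf (cyc 2) t) (suc s)) r) 4
bull-found = toWitness {a? = all? λ t → all? λ s → all? λ r → ¬? (s ≟ t) →-dec found? _ 4} _

-- In the triangle with a tail, vertex 0 is the end of the tail, 1 its middle and 2, 3, 4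
-- are the triangle.
tail-found : ∀ t r → r ≢ suc zero → Found (addLeaf (addLeaf (addLeaf (cyc 2) t) zero) r) 4
tail-found = toWitness {a? = all? λ t → all? λ r → ¬? (r ≟ suc zero) →-dec found? _ 4} _

triStar-found : Found (triStar 6) 3
triStar-found = found _

-- Cycles and induced subgraphs of a unicyclic graph

exit : ∀ {A : AdjRel n} {P : Fin n → Set} → Decidable P → ∀ {u v} → Reach A u v →
       P u → ¬ P v → ∃[ p ] ∃[ q ] (P p × ¬ P q × Edge A p q)
exit P? here Pu ¬Pv = contradiction Pu ¬Pv
exit P? (step {v = w} uw wv) Pu ¬Pv with P? w
... | yes Pw = exit P? wv Pw ¬Pv
... | no ¬Pw = _ , w , Pu , ¬Pw , uw

Image : (Fin k → Fin n) → Fin n → Set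
Image f v = ∃[ i ] f i ≡ v

image? : (f : Fin k → Fin n) → Decidable (Image f)
image? f v = any? (λ i → f i ≟ v)

missed : (f : Fin k → Fin n) → k < n → ∃[ v ] ¬ Image f v
missed f k<n with any? (¬? ∘ image? f)
... | yes missed-v = missed-v
... | no ¬missed   = contradiction (injective⇒≤ {f = proj₁ ∘ preimage} preimage-injective) (<⇒≱ k<n)
  where
  preimage : ∀ v → Image f v
  preimage v with image? f v
  ... | yes hit = hit
  ... | no ¬hit = contradiction (v , ¬hit) ¬missed

  preimage-injective : ∀ {u v} → proj₁ (preimage u) ≡ proj₁ (preimage v) → u ≡ v
  preimage-injective {u} {v} eq = trans (sym (proj₂ (preimage u))) (trans (cong f eq) (proj₂ (preimage v)))

frontier : ∀ {A : AdjRel n} → Connected A → (f : Fin (suc k) → Fin n) → suc k < n →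
           ∃[ z ] ∃[ t ] (¬ Image f z × Edge A (f t) z)
frontier conn f k<n with missed f k<n
... | v , v∉ with exit (image? f) (conn (f zero) v) (zero , refl) v∉
... | _ , z , (t , refl) , z∉ , tz = z , t , z∉ , tz

-- The list holds the vertices after the first one.
data Path (A : AdjRel n) (t : Fin n) : Fin n → List (Fin n) → Set where
  end  : Path A t t []
  cons : ∀ {s w xs} → Edge A s w → s ∉ₗ w ∷ xs → Path A t w xs → Path A t s (w ∷ xs)

path-suffix : ∀ {A : AdjRel n} {s t w xs} → s ∈ₗ w ∷ xs → Path A t w xs → ∃[ ys ] Path A t s ys
path-suffix (here refl) π           = _ , π
path-suffix (there s∈) (cons _ _ π) = path-suffix s∈ π

-- A walk that returns to `s` is cut short at that visit, which keeps the vertices distinct.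
reach⇒path : ∀ {A : AdjRel n} {s t} → Reach A s t → ∃[ xs ] Path A t s xs
reach⇒path here = [] , end
reach⇒path {n} {s = s} (step {v = w} sw wt) with reach⇒path wt
... | xs , π with DecMembership._∈?_ _≟_ s (w ∷ xs)
... | yes s∈ = path-suffix s∈ π
... | no s∉  = w ∷ xs , cons sw s∉ π

path-unique : ∀ {A : AdjRel n} {s t xs} → Path A t s xs → Unique (s ∷ xs)
path-unique end = [] ∷ []
path-unique (cons _ s∉ π) = All.¬Any⇒All¬ _ s∉ ∷ path-unique π

lookup-injective : ∀ {A : Set} {xs : List A} → Unique xs → ∀ i j → lookup xs i ≡ lookup xs j → i ≡ j
lookup-injective (_ ∷ _)       zero    zero    _  = refl
lookup-injective (x∉ ∷ _)      zero    (suc j) eq = contradiction eq (All.lookup x∉ (∈-lookup j))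
lookup-injective (x∉ ∷ _)      (suc i) zero    eq = contradiction (sym eq) (All.lookup x∉ (∈-lookup i))
lookup-injective (_ ∷ unique)  (suc i) (suc j) eq = cong suc (lookup-injective unique i j eq)

path-edge : ∀ {A : AdjRel n} {s t xs} → Path A t s xs → (i : Fin (length xs)) →
            Edge A (lookup (s ∷ xs) (inject₁ i)) (lookup (s ∷ xs) (suc i))
path-edge (cons sw _ _) zero    = sw
path-edge (cons _ _ π)  (suc i) = path-edge π i

path-last : ∀ {A : AdjRel n} {s t xs} → Path A t s xs → lookup (s ∷ xs) (fromℕ (length xs)) ≡ t
path-last end          = refl
path-last (cons _ _ π) = path-last π

next-inject₁ : ∀ {m} (i : Fin m) → next (inject₁ i) ≡ suc i
next-inject₁ {m} i = toℕ-injective (trans (toℕ-fromℕ< (m%n<n (suc (toℕ (inject₁ i))) (suc m)))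
  (trans (cong (λ x → suc x % suc m) (toℕ-inject₁ i)) (m<n⇒m%n≡m (s≤s (toℕ<n i)))))

next-fromℕ : ∀ m → next (fromℕ m) ≡ zero
next-fromℕ m = toℕ-injective (trans (toℕ-fromℕ< (m%n<n (suc (toℕ (fromℕ m))) (suc m)))
  (trans (cong (λ x → suc x % suc m) (toℕ-fromℕ m)) (n%n≡0 (suc m))))

OnCycle : {A : AdjRel n} → Cycle A → Fin n → Set
OnCycle C = Image (Cycle.vertex C)

-- Uniqueness compares edges; as each vertex of a cycle starts one of its edges, the inclusion
-- passes to vertices.
sameCycle⇒onCycle : ∀ {A : AdjRel n} {C D : Cycle A} → SameCycle C D → ∀ {v} → OnCycle C v → OnCycle D v
sameCycle⇒onCycle same (i , refl) with proj₁ (same _ _) (i , inj₁ (refl , refl))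
... | j , inj₁ (eq , _) = j , eq
... | j , inj₂ (_ , eq) = next j , eq

single : Fin n → Fin 1 → Fin n
single v _ = v

¬image-cons : ∀ {f : Fin k → Fin n} {z v} → z ≢ v → ¬ Image f v → ¬ Image (z ◂ f) v
¬image-cons z≢v v∉ (zero , z≡v)  = z≢v z≡v
¬image-cons z≢v v∉ (suc i , eq)  = v∉ (i , eq)

Distinct : (i j k l : Fin n) → Set
Distinct i j k l = i ≢ j × i ≢ k × i ≢ l × j ≢ k × j ≢ l × k ≢ l

-- The third step distinguishes the cycle from the triangle closed by a chord from i to j.
TwoApart : ∀ {m} → Fin (suc m) → Fin (suc m) → Set
TwoApart i j = next (next i) ≡ j × Distinct i (next i) (next (next i)) (next (next (next i)))

-- The length of the cycle is `suc m`. Up to length 5, vertices that are not consecutive are two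
-- steps apart, the only chords that `chordless` excludes.
Short : ℕ → Set
Short m = ∀ (i j : Fin (suc m)) → i ≡ j ⊎ next i ≡ j ⊎ next j ≡ i ⊎ TwoApart i j ⊎ TwoApart j i

short? : ∀ m → Dec (Short m)
short? m = all? λ i → all? λ j →
  (i ≟ j) ⊎-dec (next i ≟ j) ⊎-dec (next j ≟ i) ⊎-dec twoApart? i j ⊎-dec twoApart? j i
  where
  distinct? : (i j k l : Fin (suc m)) → Dec (Distinct i j k l)
  distinct? i j k l = ¬? (i ≟ j) ×-dec ¬? (i ≟ k) ×-dec ¬? (i ≟ l) ×-dec
                      ¬? (j ≟ k) ×-dec ¬? (j ≟ l) ×-dec ¬? (k ≟ l)

  twoApart? : (i j : Fin (suc m)) → Dec (TwoApart i j)
  twoApart? i j = (next (next i) ≟ j) ×-dec distinct? i (next i) (next (next i)) (next (next (next i)))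

C₃-short : Short 2
C₃-short = toWitness {a? = short? 2} _

C₄-short : Short 3
C₄-short = toWitness {a? = short? 3} _

C₅-short : Short 4
C₅-short = toWitness {a? = short? 4} _

module Graph (A : AdjRel n) (simple : IsSimple A) (C : Cycle A) (unique : ∀ D → SameCycle C D) where

  open IsSimple simple renaming (sym to A-sym)

  edge-sym : ∀ {u v} → Edge A u v → Edge A v u
  edge-sym {u} {v} uv = trans (A-sym v u) uv

  edge⇒≢ : ∀ {u v} → Edge A u v → u ≢ v
  edge⇒≢ uv refl = ¬edge uv (irrefl _)

  -- Connectedness is kept so that two neighbours of a new vertex can be joined inside the subgraph.
  record Sub (B : AdjRel k) (f : Fin k → Fin n) : Set where
    field
      induced   : Induced A B f
      connected : Connected B
    open Induced induced public

  -- As all cycles have the same vertices, no cycle can then pass through z and otherwise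
  -- only through the image of f.
  Separated : (Fin k → Fin n) → Fin n → Set
  Separated f z = ¬ OnCycle C z ⊎ (∃[ v ] (OnCycle C v × z ≢ v × ¬ Image f v))

  -- The cycle runs from `z` along the path and back; `s ≢ t` makes its length at least 3.
  close : ∀ {B : AdjRel k} {f z s t xs} → Induced A B f → ¬ Image f z → Path B t s xs → s ≢ t →
          Edge A z (f s) → Edge A (f t) z →
          Σ (Cycle A) λ D → OnCycle D z × (∀ {v} → OnCycle D v → Image (z ◂ f) v)
  close _ _ end s≢t _ _ = contradiction refl s≢t
  close {f = f} {z} {s} {t} {xs} ind z∉ π@(cons _ _ _) _ zs tz = record
    { m         = length (s ∷ xs)
    ; len≥3     = s≤s (s≤s z≤n)
    ; vertex    = vertex
    ; injective = vertex-injective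
    ; adjacent  = adjacent
    } , (zero , refl) , λ { (zero , eq) → zero , eq ; (suc i , eq) → suc _ , eq }
    where
    vertex : Fin (suc (length (s ∷ xs))) → Fin n
    vertex = z ◂ (f ∘ lookup (s ∷ xs))

    vertex-injective : ∀ i j → vertex i ≡ vertex j → i ≡ j
    vertex-injective zero    zero    _  = refl
    vertex-injective zero    (suc j) eq = contradiction (_ , sym eq) z∉
    vertex-injective (suc i) zero    eq = contradiction (_ , eq) z∉
    vertex-injective (suc i) (suc j) eq =
      cong suc (lookup-injective (path-unique π) i j (Induced.injective ind eq))

    step-edge : ∀ i → Edge A (vertex (inject₁ i)) (vertex (suc i))
    step-edge zero    = zs
    step-edge (suc i) = trans (Induced.matches ind _ _) (path-edge π i)

    adjacent : ∀ i → Edge A (vertex i) (vertex (next i))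
    adjacent i with view i
    ... | ‵inject₁ j = subst (λ l → Edge A (vertex (inject₁ j)) (vertex l)) (sym (next-inject₁ j)) (step-edge j)
    ... | ‵fromℕ     = subst₂ (λ u j → Edge A u (vertex j))
                         (sym (cong f (path-last π))) (sym (next-fromℕ (length (s ∷ xs)))) tz

  -- A path in the image between two neighbours of `z` closes a cycle `D`. It has the vertices of
  -- `C`, yet `z` is on `D` but off `C`, or some `v` is on `C` but cannot be on `D`.
  no-second-edge : ∀ {B : AdjRel k} {f z} → Sub B f → ¬ Image f z → Separated f z →
                   ∀ {s t} → s ≢ t → Edge A z (f s) → A z (f t) ≢ true
  no-second-edge sub z∉ sep {s} {t} s≢t zs zt with reach⇒path (Sub.connected sub t s)
  ... | _ , π with close (Sub.induced sub) z∉ π (≢-sym s≢t) zt (edge-sym zs)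
  ... | D , z∈D , D⊆ with sep
  ... | inj₁ z∉C = z∉C (sameCycle⇒onCycle {C = D} {C} (λ u v → swap (unique D u v)) z∈D)
  ... | inj₂ (v , v∈C , z≢v , v∉) =
    ¬image-cons z≢v v∉ (D⊆ (sameCycle⇒onCycle {C = C} {D} (unique D) v∈C))

  extend : ∀ {B : AdjRel k} {f z t} → Sub B f → ¬ Image f z → Separated f z → Edge A (f t) z →
           Sub (addLeaf B t) (z ◂ f)
  extend {B = B} {f} {z} {t} sub z∉ sep tz = record
    { induced   = record { injective = injective′ _ _ ; matches = matches′ }
    ; connected = connected′
    }
    where
    open Sub sub
    injective′ : ∀ i j → (z ◂ f) i ≡ (z ◂ f) j → i ≡ j
    injective′ zero    zero    _  = refl
    injective′ zero    (suc j) eq = contradiction (j , sym eq) z∉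
    injective′ (suc i) zero    eq = contradiction (i , eq) z∉
    injective′ (suc i) (suc j) eq = cong suc (injective eq)

    row : ∀ j → A z (f j) ≡ ⌊ t ≟ j ⌋
    row j with t ≟ j
    ... | yes refl = edge-sym tz
    ... | no t≢j   = Bool.¬-not (no-second-edge sub z∉ sep t≢j (edge-sym tz))

    matches′ : ∀ i j → A ((z ◂ f) i) ((z ◂ f) j) ≡ addLeaf B t i j
    matches′ zero    zero    = irrefl z
    matches′ zero    (suc j) = row j
    matches′ (suc i) zero    = trans (A-sym (f i) z) (row i)
    matches′ (suc i) (suc j) = matches i j

    lift : ∀ {i j} → Reach B i j → Reach (addLeaf B t) (suc i) (suc j)
    lift here          = here
    lift (step ij jk) = step ij (lift jk)

    t-edge : ⌊ t ≟ t ⌋ ≡ true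
    t-edge = trans (isYes≗does (t ≟ t)) (dec-true (t ≟ t) refl)

    to-new : ∀ {i j} → Reach (addLeaf B t) i j → j ≡ suc t → Reach (addLeaf B t) i zero
    to-new here refl       = step t-edge here
    to-new (step ij jk) eq = step ij (to-new jk eq)

    connected′ : Connected (addLeaf B t)
    connected′ zero    zero    = here
    connected′ zero    (suc j) = step t-edge (lift (connected t j))
    connected′ (suc i) zero    = to-new (lift (connected i t)) refl
    connected′ (suc i) (suc j) = lift (connected i j)

  single-sub : ∀ v → Sub (path 0) (single v)
  single-sub v = record
    { induced   = record { injective = λ { {zero} {zero} _ → refl } ; matches = λ _ _ → irrefl v }
    ; connected = λ { zero zero → here }
    }

  avoid : ∀ {f : Fin k → Fin n} {z v} → OnCycle C v → z ≢ v → ¬ Image f v → Separated f z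
  avoid v∈C z≢v v∉ = inj₂ (_ , v∈C , z≢v , v∉)

  open Cycle C using (m; vertex; adjacent) renaming (injective to vertex-injective)

  vertex-≢ : ∀ {i j} → i ≢ j → vertex i ≢ vertex j
  vertex-≢ i≢j eq = i≢j (vertex-injective _ _ eq)

  -- The arc through `i`, `j`, `k` omits the cycle vertex at `l`, so `extend` makes it an induced
  -- path, whose ends are not adjacent.
  chordless : ∀ i → let j = next i; k = next j; l = next k in
              Distinct i j k l → A (vertex i) (vertex k) ≡ false
  chordless i (i≢j , i≢k , i≢l , j≢k , j≢l , k≢l) = trans (A-sym _ _) (Sub.matches arc₃ zero (suc (suc zero)))
    where
    l-on = next (next (next i)) , refl
    arc₁ = single-sub (vertex i)
    arc₂ = extend {t = zero} arc₁ (vertex-≢ i≢j ∘ proj₂)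
             (avoid l-on (vertex-≢ j≢l) (vertex-≢ i≢l ∘ proj₂)) (adjacent i)
    arc₃ = extend {t = zero} arc₂ (¬image-cons (vertex-≢ j≢k) (vertex-≢ i≢k ∘ proj₂))
             (avoid l-on (vertex-≢ k≢l) (¬image-cons (vertex-≢ j≢l) (vertex-≢ i≢l ∘ proj₂))) (adjacent (next i))

  cycle-sub : Short m → Sub (cyc m) vertex
  cycle-sub short = record
    { induced   = record { injective = vertex-injective _ _ ; matches = matches }
    ; connected = connected
    }
    where
    next-edge : ∀ {i j} → next i ≡ j → Edge A (vertex i) (vertex j)
    next-edge refl = adjacent _

    matches : ∀ i j → A (vertex i) (vertex j) ≡ cyc m i j
    matches i j with next i ≟ j | next j ≟ i
    ... | yes i→j | _       = next-edge i→j
    ... | no _    | yes j→i = edge-sym (next-edge j→i)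
    ... | no i↛j  | no j↛i with short i j
    ... | inj₁ refl                              = irrefl _
    ... | inj₂ (inj₁ i→j)                        = contradiction i→j i↛j
    ... | inj₂ (inj₂ (inj₁ j→i))                 = contradiction j→i j↛i
    ... | inj₂ (inj₂ (inj₂ (inj₁ (refl , dist)))) = chordless i dist
    ... | inj₂ (inj₂ (inj₂ (inj₂ (refl , dist)))) = trans (A-sym _ _) (chordless j dist)

    forth : ∀ i → Edge (cyc m) i (next i)
    forth i = cong (_∨ ⌊ next (next i) ≟ i ⌋) (trans (isYes≗does (next i ≟ next i)) (dec-true (next i ≟ next i) refl))

    back : ∀ i → Edge (cyc m) (next i) i
    back i = trans (Bool.∨-comm ⌊ next (next i) ≟ i ⌋ _) (forth i)

    connected : Connected (cyc m)
    connected i j with short i j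
    ... | inj₁ refl                           = here
    ... | inj₂ (inj₁ refl)                    = step (forth i) here
    ... | inj₂ (inj₂ (inj₁ refl))             = step (back j) here
    ... | inj₂ (inj₂ (inj₂ (inj₁ (refl , _)))) = step (forth i) (step (forth (next i)) here)
    ... | inj₂ (inj₂ (inj₂ (inj₂ (refl , _)))) = step (back (next j)) (step (back j) here)

  nth : ℕ → Fin (suc m)
  nth zero    = zero
  nth (suc i) = next (nth i)

  toℕ-nth : ∀ i → i ≤ m → toℕ (nth i) ≡ i
  toℕ-nth zero    _   = refl
  toℕ-nth (suc i) i<m = trans (toℕ-fromℕ< (m%n<n (suc (toℕ (nth i))) (suc m)))
    (trans (cong (λ x → suc x % suc m) (toℕ-nth i (<⇒≤ i<m))) (m<n⇒m%n≡m (s≤s i<m)))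

  nth-≢ : ∀ {i j} → i < j → j ≤ m → vertex (nth i) ≢ vertex (nth j)
  nth-≢ {i} {j} i<j j≤m = vertex-≢ λ eq → <⇒≢ i<j
    (trans (sym (toℕ-nth i (≤-trans (<⇒≤ i<j) j≤m))) (trans (cong toℕ eq) (toℕ-nth j j≤m)))

  arc : ∀ k → Fin (suc k) → Fin n
  arc zero    = single (vertex zero)
  arc (suc k) = vertex (nth (suc k)) ◂ arc k

  arc-head : ∀ k → arc k zero ≡ vertex (nth k)
  arc-head zero    = refl
  arc-head (suc k) = refl

  nth∉arc : ∀ k {l} → k < l → l ≤ m → ¬ Image (arc k) (vertex (nth l))
  nth∉arc zero    0<l l≤m (_ , eq) = nth-≢ 0<l l≤m eq
  nth∉arc (suc k) k<l l≤m = ¬image-cons (nth-≢ k<l l≤m) (nth∉arc k (<⇒≤ k<l) l≤m)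

  -- The arc leaves out the next cycle vertex, so a chord of it would close a second cycle.
  arc-sub : ∀ k → k < m → Sub (path k) (arc k)
  arc-sub zero    _   = single-sub (vertex zero)
  arc-sub (suc k) k<m = extend {t = zero} (arc-sub k (<⇒≤ k<m)) (nth∉arc k (n<1+n k) (<⇒≤ k<m))
    (avoid (_ , refl) (nth-≢ (n<1+n (suc k)) k<m) (nth∉arc k (s≤s (n≤1+n k)) k<m))
    (subst (λ u → Edge A u (vertex (nth (suc k)))) (sym (arc-head k)) (adjacent (nth k)))

  Covers : (Fin k → Fin n) → Set
  Covers f = ∀ {v} → OnCycle C v → Image f v

  covers-cons : ∀ {f : Fin k → Fin n} {z} → Covers f → Covers (z ◂ f)
  covers-cons covers v∈ with covers v∈
  ... | i , eq = suc i , eq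

  -- A vertex outside an image that covers the cycle is off the cycle, hence separated.
  attach : ∀ {B : AdjRel k} {f z t} → Sub B f → Covers f → ¬ Image f z → Edge A (f t) z → Sub (addLeaf B t) (z ◂ f)
  attach sub covers z∉ tz = extend sub z∉ (inj₁ (z∉ ∘ covers)) tz

  cycle-covers : Covers vertex
  cycle-covers v∈ = v∈

-- Recognising the vertex sum

-- Abstract, so that the type checker never unfolds the permutations built here.
abstract
  permutation-extending : ∀ {j} (g : Fin j → Fin (j + k)) → (∀ {a b} → g a ≡ g b → a ≡ b) →
                          Σ (Permutation′ (j + k)) λ σ → ∀ i → σ ⟨$⟩ʳ (i ↑ˡ k) ≡ g i
  permutation-extending {j = zero} g g-injective = Perm.id , λ ()
  permutation-extending {k} {suc j} g g-injective = prepend rest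
    where
    g₀≢ : ∀ i → g zero ≢ g (suc i)
    g₀≢ i eq = 0≢1+n (g-injective eq)

    rest : Σ (Permutation′ (j + k)) λ σ → ∀ i → σ ⟨$⟩ʳ (i ↑ˡ k) ≡ punchOut (g₀≢ i)
    rest = permutation-extending (λ i → punchOut (g₀≢ i))
             (λ eq → suc-injective (g-injective (punchOut-injective (g₀≢ _) (g₀≢ _) eq)))

    prepend : (Σ (Permutation′ (j + k)) λ σ → ∀ i → σ ⟨$⟩ʳ (i ↑ˡ k) ≡ punchOut (g₀≢ i)) →
              Σ (Permutation′ (suc j + k)) λ σ → ∀ i → σ ⟨$⟩ʳ (i ↑ˡ k) ≡ g i
    prepend (σ , σ-agrees) = insert zero (g zero) σ , λ where
      zero    → refl
      (suc i) → trans (insert-punchIn zero (g zero) σ (i ↑ˡ k))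
                  (trans (cong (punchIn (g zero)) (σ-agrees i)) (punchIn-punchOut (g₀≢ i)))

-- The vertices of a triangle with a leaf at t, in the order of triStar.
position : Fin 3 → Fin 4 → Fin 4
position t = zero ◂ suc t ◂ suc (next t) ◂ suc (next (next t)) ◂ ◂[]

abstract
  position-injective : ∀ t a b → position t a ≡ position t b → a ≡ b
  position-injective = toWitness {a? = all? λ t → all? λ a → all? λ b → (position t a ≟ position t b) →-dec (a ≟ b)} _

  position-surjective : ∀ t j → ∃[ i ] position t i ≡ j
  position-surjective = toWitness {a? = all? λ t → all? λ j → any? λ i → position t i ≟ j} _

  core-matches : ∀ t i j → addLeaf (cyc 2) t (position t i) (position t j) ≡ triStar 4 i j
  core-matches = toWitness {a? = all? λ t → all? λ i → all? λ j →
                     addLeaf (cyc 2) t (position t i) (position t j) Bool.≟ triStar 4 i j} _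

leaf-matches : ∀ k t j (l : Fin k) →
               addLeaf (addLeaf (cyc 2) t) zero zero (suc (position t j)) ≡ triStar (4 + k) (4 ↑ʳ l) (j ↑ˡ k)
leaf-matches k t zero                   l = refl
leaf-matches k t (suc zero)             l = refl
leaf-matches k t (suc (suc zero))       l = refl
leaf-matches k t (suc (suc (suc zero))) l = refl

triStar-sym : ∀ (i j : Fin n) → triStar n i j ≡ triStar n j i
triStar-sym i j = Bool.∨-comm (triStarEdge (toℕ i) (toℕ j)) (triStarEdge (toℕ j) (toℕ i))

triStar-core : ∀ {m} k i j → triStar (m + k) (i ↑ˡ k) (j ↑ˡ k) ≡ triStar m i j
triStar-core k i j = cong₂ (λ a b → triStarEdge a b ∨ triStarEdge b a) (toℕ-↑ˡ i k) (toℕ-↑ˡ j k)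

split : ∀ m (i : Fin (m + k)) → (∃[ j ] j ↑ˡ k ≡ i) ⊎ (∃[ l ] m ↑ʳ l ≡ i)
split m i with splitAt m i in eq
... | inj₁ j = inj₁ (j , splitAt⁻¹-↑ˡ eq)
... | inj₂ l = inj₂ (l , splitAt⁻¹-↑ʳ eq)

module Recognise {k} (A : AdjRel (4 + k)) (simple : IsSimple A) (C : Cycle A) (unique : ∀ D → SameCycle C D)
  {f : Fin 3 → Fin (4 + k)} (covers : Graph.Covers A simple C unique f)
  where

  open Graph A simple C unique

  recognise : ∀ {x t} → Sub (addLeaf (cyc 2) t) (x ◂ f) →
              (∀ v → ¬ Image (x ◂ f) v → Edge A x v) → Isomorphic A (triStar (4 + k))
  recognise {x} {t} core pendant = flip σ , λ u v →
    trans (sym (matches (σ ⟨$⟩ˡ u) (σ ⟨$⟩ˡ v))) (cong₂ A (inverseʳ σ) (inverseʳ σ))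
    where
    g : Fin 4 → Fin (4 + k)
    g = (x ◂ f) ∘ position t

    -- Indices 0 to 3 go to the core in the order of `triStar`, all others to the leaves. The
    -- isomorphism sought is the inverse.
    extension = permutation-extending {k} g (position-injective t _ _ ∘ Sub.injective core)
    σ = proj₁ extension

    σ-leaf : ∀ l → ¬ Image (x ◂ f) (σ ⟨$⟩ʳ (4 ↑ʳ l))
    σ-leaf l (j , eq) with position-surjective t j
    ... | i , refl with trans (sym (splitAt-↑ˡ 4 i k)) (trans (cong (splitAt 4)
                         (Injection.injective (↔⇒↣ σ) (trans (proj₂ extension i) eq))) (splitAt-↑ʳ 4 k l))
    ... | ()

    with-leaf : ∀ l → Sub (addLeaf (addLeaf (cyc 2) t) zero) ((σ ⟨$⟩ʳ (4 ↑ʳ l)) ◂ x ◂ f)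
    with-leaf l = attach core (covers-cons covers) (σ-leaf l) (pendant _ (σ-leaf l))

    leaf-core : ∀ l i → A (σ ⟨$⟩ʳ (4 ↑ʳ l)) (σ ⟨$⟩ʳ (i ↑ˡ k)) ≡ triStar (4 + k) (4 ↑ʳ l) (i ↑ˡ k)
    leaf-core l i = trans (cong (A _) (proj₂ extension i))
      (trans (Sub.matches (with-leaf l) zero (suc (position t i))) (leaf-matches k t i l))

    leaf-leaf : ∀ l l′ → A (σ ⟨$⟩ʳ (4 ↑ʳ l)) (σ ⟨$⟩ʳ (4 ↑ʳ l′)) ≡ false
    leaf-leaf l l′ with l ≟ l′
    ... | yes refl = IsSimple.irrefl simple _
    -- With both leaves attached to the core, the induced subgraph shows that they are not adjacent.
    ... | no l≢l′  = Sub.matches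
      (attach {t = suc zero} (with-leaf l′) (covers-cons (covers-cons covers))
        (¬image-cons (l≢l′ ∘ sym ∘ ↑ʳ-injective 4 _ _ ∘ Injection.injective (↔⇒↣ σ)) (σ-leaf l))
        (pendant _ (σ-leaf l)))
      zero (suc zero)

    matches : ∀ i j → A (σ ⟨$⟩ʳ i) (σ ⟨$⟩ʳ j) ≡ triStar (4 + k) i j
    matches i j with split 4 i | split 4 j
    ... | inj₁ (i′ , refl) | inj₁ (j′ , refl) =
      trans (cong₂ A (proj₂ extension i′) (proj₂ extension j′))
        (trans (Sub.matches core (position t i′) (position t j′)) (trans (core-matches t i′ j′) (sym (triStar-core k i′ j′))))
    ... | inj₁ (i′ , refl) | inj₂ (l , refl) =
      trans (IsSimple.sym simple _ _) (trans (leaf-core l i′) (triStar-sym (4 ↑ʳ l) (i′ ↑ˡ k)))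
    ... | inj₂ (l , refl) | inj₁ (j′ , refl) = leaf-core l j′
    ... | inj₂ (l , refl) | inj₂ (l′ , refl) = leaf-leaf l l′

-- Unicyclic graphs without a chain of length 4

found⇒chain : ∀ {A : AdjRel n} {B : AdjRel k} {f} m → Induced A B f → Found B m → HasChain A m
found⇒chain {B = B} m ind (found success) = chain-map ind (to-witness-T (search B m) success)

-- The first step of a walk in the complement leads to one. Connectedness of the complement enters
-- the proof through this.
non-neighbour : ∀ {A : AdjRel n} {u v} → u ≢ v → Reach (complement A) u v → ∃[ w ] (u ≢ w × A u w ≡ false)
non-neighbour u≢v here = contradiction refl u≢v
non-neighbour {A = A} {u} u≢v (step {v = w} uw _) with A u w in eq | u ≟ w
non-neighbour u≢v (step {v = w} uw _) | false | no u≢w = w , u≢w , eq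

C₃-complete : ∀ i j → i ≢ j → cyc 2 i j ≡ true
C₃-complete = toWitness {a? = all? λ i → all? λ j → ¬? (i ≟ j) →-dec (cyc 2 i j Bool.≟ true)} _

module ChainFree (A : AdjRel n) (simple : IsSimple A) (C : Cycle A) (unique : ∀ D → SameCycle C D)
  (conn : Connected A) (no-chain : ¬ HasChain A 4)
  where

  open Graph A simple C unique public

  refute : ∀ {B : AdjRel k} {f} → Sub B f → ¬ Found B 4
  refute sub 4-found = no-chain (found⇒chain 4 (Sub.induced sub) 4-found)

  grow : ∀ {B : AdjRel (suc k)} {f} → Sub B f → Covers f → suc k < n →
         ∃[ z ] ∃[ t ] Sub (addLeaf B t) (z ◂ f)
  grow {f = f} sub covers k<n with frontier conn f k<n
  ... | z , t , z∉ , tz = z , t , attach sub covers z∉ tz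

  refute-grown : ∀ {B : AdjRel (suc k)} {f} → Sub B f → Covers f → suc k < n →
                 ¬ (∀ t → Found (addLeaf B t) 4)
  refute-grown sub covers k<n all-found =
    let _ , t , sub′ = grow sub covers k<n in refute sub′ (all-found t)

  -- The length is at least 6 here, so the five vertices of `arc 4` and the next one on the cycle
  -- are distinct.
  long-cycle : 5 ≤ Cycle.m C → ⊥
  long-cycle 5≤m = refute (arc-sub 4 5≤m) P₅-found

-- The case of a triangle

module Triangle {k} (A : AdjRel (6 + k)) (simple : IsSimple A) (C : Cycle A) (unique : ∀ D → SameCycle C D)
  (conn : Connected A) (co-conn : Connected (complement A)) (no-chain : ¬ HasChain A 4)
  {f : Fin 3 → Fin (6 + k)} (triangle : Graph.Sub A simple C unique (cyc 2) f) (covers : Graph.Covers A simple C unique f)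
  where

  open ChainFree A simple C unique conn no-chain

  -- In a triangle, `f t` is adjacent to both other vertices.
  far⇒∉ : ∀ {t v} → f t ≢ v → A (f t) v ≡ false → ¬ Image f v
  far⇒∉ {t} t≢v t≁v (i , refl) with t ≟ i
  ... | yes refl = t≢v refl
  ... | no t≢i   = ¬edge (trans (Sub.matches triangle t i) (C₃-complete t i t≢i)) t≁v

  -- Leaves `x` and `q` at different corners form a bull, and the order leaves room for a sixth
  -- vertex.
  no-bull : ∀ {t s x q} → s ≢ t → Sub (addLeaf (cyc 2) t) (x ◂ f) → x ≢ q → ¬ Image f q → ¬ Edge A (f s) q
  no-bull {t} {s} s≢t paw x≢q q∉ sq =
    refute-grown bull (covers-cons (covers-cons covers)) (m≤m+n 6 k) (λ r → bull-found t s r s≢t)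
    where
    bull = attach {t = suc s} paw (covers-cons covers) (¬image-cons x≢q q∉) sq

  module Tail {t x q} (paw : Sub (addLeaf (cyc 2) t) (x ◂ f)) (q∉ : ¬ Image (x ◂ f) q) (xq : Edge A x q) where

    tail-only : ∀ {y r v} → ¬ Image (x ◂ f) y → Edge A x y → ¬ Image (y ◂ x ◂ f) v → r ≢ suc zero →
                ¬ Edge A ((y ◂ x ◂ f) r) v
    tail-only {r = r} y∉ xy v∉ r≢1 rv = refute
      (attach {t = r} (attach {t = zero} paw (covers-cons covers) y∉ xy) (covers-cons (covers-cons covers)) v∉ rv)
      (tail-found t r r≢1)

    Near : Fin (6 + k) → Set
    Near v = Image (x ◂ f) v ⊎ Edge A x v

    near? : ∀ v → Dec (Near v)
    near? v = image? (x ◂ f) v ⊎-dec (A x v Bool.≟ true)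

    -- A walk from `x` to a far vertex would cross from a near `p` to a far `w`. If `p` is on the
    -- triangle, `w` hangs there beside the tail ending in `q`; if `p` is a leaf at `x`, `w`
    -- prolongs the tail ending in `p`. Both are excluded by `tail-only`.
    all-near : ∀ v → Near v
    all-near v = decidable-stable (near? v) λ v-far → beyond (exit near? (conn x v) (inj₁ (zero , refl)) v-far)
      where
      from-core : ∀ {p w} → Image (x ◂ f) p → ¬ Near w → ¬ Edge A p w
      from-core (zero , refl) w-far xw = w-far (inj₂ xw)
      from-core (suc i , refl) w-far iw =
        tail-only {r = suc (suc i)} q∉ xq (¬image-cons (λ { refl → w-far (inj₂ xq) }) (w-far ∘ inj₁)) (λ ()) iw

      beyond : ¬ (∃[ p ] ∃[ w ] (Near p × ¬ Near w × Edge A p w))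
      beyond (p , w , inj₁ p∈ , w-far , pw) = from-core p∈ w-far pw
      beyond (p , w , inj₂ xp , w-far , pw) with image? (x ◂ f) p
      ... | yes p∈ = from-core p∈ w-far pw
      ... | no p∉  = tail-only {r = zero} p∉ xp (¬image-cons (edge⇒≢ pw) (w-far ∘ inj₁)) (λ ()) pw

    isomorphic : Isomorphic A (triStar (6 + k))
    isomorphic = recognise paw λ v v∉ → fromInj₂ (λ v∈ → contradiction v∈ v∉) (all-near v)
      where open Recognise A simple C unique covers

  isomorphic : Isomorphic A (triStar (6 + k))
  isomorphic with frontier conn f (m≤m+n 4 (2 + k))
  ... | z , t , z∉ , tz with attach triangle covers z∉ tz | non-neighbour (edge⇒≢ tz) (co-conn (f t) z)
  ... | paw | w , t≢w , t≁w
    -- The walk to `w` leaves the closed neighbourhood of `f t` along an edge from `p` to `q`. If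
    -- `p` is on the triangle, `z` and `q` complete a bull; otherwise `f t`, `p`, `q` is the tail.
    with exit (λ v → (f t ≟ v) ⊎-dec (A (f t) v Bool.≟ true)) (conn (f t) w) (inj₁ refl)
           [ t≢w , (λ tw → ¬edge tw t≁w) ]
  ... | p , q , inj₁ refl , q-far , tq = contradiction (inj₂ tq) q-far
  ... | p , q , inj₂ tp , q-far , pq with far⇒∉ {t} (q-far ∘ inj₁) (Bool.¬-not (q-far ∘ inj₂)) | image? f p
  ... | q∉ | yes (s , refl) = contradiction pq
    (no-bull (λ { refl → edge⇒≢ tp refl }) paw (λ { refl → q-far (inj₂ tz) }) q∉)
  ... | q∉ | no p∉ = Tail.isomorphic (attach triangle covers p∉ tp) (¬image-cons (edge⇒≢ pq) q∉) pq

chain-free⇒isomorphic : ∀ (A : AdjRel (6 + k)) → IsSimple A → (C : Cycle A) → (∀ D → SameCycle C D) →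
  Connected A → Connected (complement A) → ¬ HasChain A 4 → Isomorphic A (triStar (6 + k))
chain-free⇒isomorphic A simple record { m = 0 ; len≥3 = () }
chain-free⇒isomorphic A simple record { m = 1 ; len≥3 = s≤s () }
chain-free⇒isomorphic A simple C@record { m = 2 } unique conn co-conn no-chain =
  Triangle.isomorphic A simple C unique conn co-conn no-chain (cycle-sub C₃-short) cycle-covers
  where open ChainFree A simple C unique conn no-chain
chain-free⇒isomorphic {k} A simple C@record { m = 3 } unique conn co-conn no-chain =
  let _ , s , sub = grow (cycle-sub C₄-short) cycle-covers (m≤m+n 5 (1 + k))
  in contradiction (C₄-found s) (refute-grown sub (covers-cons cycle-covers) (m≤m+n 6 k))
  where open ChainFree A simple C unique conn no-chain
chain-free⇒isomorphic {k} A simple C@record { m = 4 } unique conn co-conn no-chain =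
  contradiction C₅-found (refute-grown (cycle-sub C₅-short) cycle-covers (m≤m+n 6 k))
  where open ChainFree A simple C unique conn no-chain
chain-free⇒isomorphic A simple C@record { m = suc (suc (suc (suc (suc m)))) } unique conn co-conn no-chain =
  contradiction (m≤m+n 5 m) (ChainFree.long-cycle A simple C unique conn no-chain)

-- Forts of the vertex sum

members : ∀ m (p : Subset n) → m ≤ ∣ p ∣ →
          Σ (Fin m → Fin n) λ g → (∀ {a b} → g a ≡ g b → a ≡ b) × (∀ a → g a ∈ p)
members zero    p             m≤ = (λ ()) , (λ { {()} }) , λ ()
members (suc m) (outside ∷ p) m≤ with members (suc m) p m≤
... | g , g-injective , g∈ = suc ∘ g , g-injective ∘ suc-injective , there ∘ g∈
members (suc m) (inside ∷ p) (s≤s m≤) with members m p m≤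
... | g , g-injective , g∈ = g′ , g′-injective _ _ , g′∈
  where
  g′ : Fin (suc m) → Fin _
  g′ = zero ◂ (suc ∘ g)

  g′-injective : ∀ a b → g′ a ≡ g′ b → a ≡ b
  g′-injective zero    zero    _  = refl
  g′-injective (suc a) (suc b) eq = cong suc (g-injective (suc-injective eq))

  g′∈ : ∀ a → g′ a ∈ inside ∷ p
  g′∈ zero    = here
  g′∈ (suc a) = there (g∈ a)

injective⇒onto : ∀ {m} (h : Fin m → Fin m) → (∀ {a b} → h a ≡ h b → a ≡ b) → ∀ c → ∃[ a ] h a ≡ c
injective⇒onto {suc m} h h-injective c = decidable-stable (any? λ a → h a ≟ c) λ c∉ →
  let c≢ : ∀ a → c ≢ h a
      c≢ a eq = c∉ (a , sym eq)
  in 1+n≰n (injective⇒≤ {f = λ a → punchOut (c≢ a)}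
             (λ eq → h-injective (punchOut-injective (c≢ _) (c≢ _) eq)))

Fort : AdjRel n → (Fin n → Set) → Set
Fort B F = ∀ {u w} → ¬ F u → F w → Edge B u w → ∃[ w′ ] (w′ ≢ w × F w′ × Edge B u w′)

-- The first vertex of a fort to be forced would have a forcing neighbour outside
-- the fort, and this neighbour has a second neighbour in the fort.
fort-unforced : ∀ {A : AdjRel n} {F S} → Fort A F → (∀ {w} → w ∈ S → ¬ F w) → ∀ {v} → Forced A S v → ¬ F v
fort-unforced fort avoids (init v∈) = avoids v∈
fort-unforced fort avoids (force u-forced uw others) Fw
  with fort (fort-unforced fort avoids u-forced) Fw uw
... | w′ , w′≢w , Fw′ , uw′ = fort-unforced fort avoids (others w′ uw′ w′≢w) Fw′

-- Two vertices of triStar have the same class when they are twins: the centre, the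
-- identified vertex, the other two triangle vertices and the leaves form the four classes.
coreClass : Fin 4 → Fin 4
coreClass (suc (suc (suc zero))) = suc (suc zero)
coreClass i                      = i

leafClass : Fin 4
leafClass = suc (suc (suc zero))

class : Fin (4 + k) → Fin 4
class i = [ coreClass ∘ proj₁ , (λ _ → leafClass) ] (split 4 i)

-- The quotient of `triStar` by twins. The third class is joined to itself because its two vertices
-- are adjacent, so only distinct vertices can be compared through it.
classEdge : Fin 4 → Fin 4 → Bool
classEdge zero             (suc zero)             = true
classEdge zero             (suc (suc (suc zero))) = true
classEdge (suc zero)       zero                   = true
classEdge (suc zero)       (suc (suc zero))       = true
classEdge (suc (suc zero)) (suc zero)             = true
classEdge (suc (suc zero)) (suc (suc zero))       = true
classEdge (suc (suc (suc zero))) zero             = true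
classEdge _                _                      = false

core-classEdge : ∀ i j → i ≢ j → triStar 4 i j ≡ classEdge (coreClass i) (coreClass j)
core-classEdge = toWitness {a? = all? λ i → all? λ j →
  ¬? (i ≟ j) →-dec (triStar 4 i j Bool.≟ classEdge (coreClass i) (coreClass j))} _

leaf-classEdge : ∀ k i (l : Fin k) → triStar (4 + k) (4 ↑ʳ l) (i ↑ˡ k) ≡ classEdge leafClass (coreClass i)
leaf-classEdge k zero                   l = refl
leaf-classEdge k (suc zero)             l = refl
leaf-classEdge k (suc (suc zero))       l = refl
leaf-classEdge k (suc (suc (suc zero))) l = refl

classEdge-sym : ∀ c d → classEdge c d ≡ classEdge d c
classEdge-sym = toWitness {a? = all? λ c → all? λ d → classEdge c d Bool.≟ classEdge d c} _

triStar-classEdge : ∀ k (u v : Fin (4 + k)) → u ≢ v → triStar (4 + k) u v ≡ classEdge (class u) (class v)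
triStar-classEdge k u v u≢v with split 4 u | split 4 v
... | inj₁ (i , refl) | inj₁ (j , refl) = trans (triStar-core k i j) (core-classEdge i j (u≢v ∘ cong (_↑ˡ k)))
... | inj₁ (i , refl) | inj₂ (l , refl) =
  trans (triStar-sym (i ↑ˡ k) (4 ↑ʳ l)) (trans (leaf-classEdge k i l) (classEdge-sym leafClass (coreClass i)))
... | inj₂ (l , refl) | inj₁ (i , refl) = leaf-classEdge k i l
... | inj₂ (l , refl) | inj₂ (l′ , refl) = refl

coreClass-one : ∀ i j → coreClass i ≡ suc zero → coreClass j ≡ suc zero → i ≡ j
coreClass-one = toWitness {a? = all? λ i → all? λ j →
  (coreClass i ≟ suc zero) →-dec (coreClass j ≟ suc zero) →-dec (i ≟ j)} _

class-one : ∀ {u v : Fin (4 + k)} → class u ≡ suc zero → class v ≡ suc zero → u ≡ v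
class-one {k} {u} {v} cu cv with split 4 u | split 4 v
... | inj₁ (i , refl) | inj₁ (j , refl) = cong (_↑ˡ k) (coreClass-one i j cu cv)

-- In terms of classes: {1, 2 or 3, a leaf} is a fort of triStar.
transversal : ∀ c d → c ≢ suc zero → d ≢ zero → classEdge c d ≡ true →
              ∃[ e ] (e ≢ d × e ≢ zero × classEdge c e ≡ true)
transversal = toWitness {a? = all? λ c → all? λ d →
  ¬? (c ≟ suc zero) →-dec ¬? (d ≟ zero) →-dec (classEdge c d Bool.≟ true) →-dec
  any? λ e → ¬? (e ≟ d) ×-dec ¬? (e ≟ zero) ×-dec (classEdge c e Bool.≟ true)} _

-- The zero forcing number of the vertex sum

module Converse {k} (A : AdjRel (6 + k)) (simple : IsSimple A) (φ : Fin (6 + k) ↔ Fin (6 + k))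
  (φ-iso : ∀ u v → triStar (6 + k) (Inverse.to φ u) (Inverse.to φ v) ≡ A u v)
  where

  open Inverse φ using (to; from)

  to-injective : ∀ {u v} → to u ≡ to v → u ≡ v
  to-injective = Injection.injective (↔⇒↣ φ)

  -- The first six vertices of the larger vertex sum form the smaller one, which supplies the chain
  -- of length 3.
  from-induced : Induced A (triStar 6) (λ i → from (i ↑ˡ k))
  from-induced = record
    { injective = λ eq → ↑ˡ-injective k _ _ (trans (sym (to-from _)) (trans (cong to eq) (to-from _)))
    ; matches   = λ i j → trans (sym (φ-iso _ _))
                    (trans (cong₂ (triStar (6 + k)) (to-from _) (to-from _)) (triStar-core k i j))
    }
    where
    to-from : ∀ v → to (from v) ≡ v
    to-from _ = Inverse.inverseˡ φ refl

  classAt : Fin (6 + k) → Fin 4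
  classAt v = class (to v)

  A-classEdge : ∀ {u v} → u ≢ v → A u v ≡ classEdge (classAt u) (classAt v)
  A-classEdge {u} {v} u≢v = trans (sym (φ-iso u v)) (triStar-classEdge (2 + k) (to u) (to v) (u≢v ∘ to-injective))

  -- A vertex outside the pair is adjacent to both twins or to neither.
  twins-fort : ∀ {a b} → a ≢ b → classAt a ≡ classAt b → Fort A (λ v → v ≡ a ⊎ v ≡ b)
  twins-fort {a} {b} a≢b same {u} u∉ w∈ uw = go w∈ uw
    where
    twin : A u a ≡ A u b
    twin = trans (A-classEdge (u∉ ∘ inj₁)) (trans (cong (classEdge (classAt u)) same) (sym (A-classEdge (u∉ ∘ inj₂))))

    go : ∀ {w} → w ≡ a ⊎ w ≡ b → Edge A u w → ∃[ w′ ] (w′ ≢ w × (w′ ≡ a ⊎ w′ ≡ b) × Edge A u w′)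
    go (inj₁ refl) ua = b , ≢-sym a≢b , inj₂ refl , trans (sym twin) ua
    go (inj₂ refl) ub = a , a≢b , inj₁ refl , trans twin ub

  -- Class one has a single vertex, which lies in the fort, so `u` has another class and
  -- `transversal` offers a second class adjacent to it; `onto` finds a member of that class.
  transversal-fort : ∀ {m} (g : Fin m → Fin (6 + k)) → (∀ c → ∃[ i ] classAt (g i) ≡ c) →
                     Fort A (λ v → Image g v × classAt v ≢ zero)
  transversal-fort g onto {u} {w} u∉ w∈ uw
    with transversal (classAt u) (classAt w) u-class (proj₂ w∈) (trans (sym (A-classEdge λ { refl → u∉ w∈ })) uw)
    where
    u-class : classAt u ≢ suc zero
    u-class cu with onto (suc zero)
    ... | i , ci = u∉ ((i , to-injective (class-one ci cu)) , λ cu′ → contradiction (trans (sym cu) cu′) λ ())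
  ... | e , e≢ , e≢0 , ue with onto e
  ... | i , refl = g i , (λ { refl → e≢ refl }) , gi∈ , trans (A-classEdge λ { refl → u∉ gi∈ }) ue
    where
    gi∈ : Image g (g i) × classAt (g i) ≢ zero
    gi∈ = (i , refl) , e≢0

  few-whites : ∀ {S} → IsZeroForcingSet A S → (g : Fin 4 → Fin (6 + k)) → (∀ {a b} → g a ≡ g b → a ≡ b) →
               ¬ (∀ a → g a ∉ S)
  few-whites {S} forcing g g-injective white
    with any? (λ a → any? λ b → ¬? (a ≟ b) ×-dec (classAt (g a) ≟ classAt (g b)))
  ... | yes (a , b , a≢b , same) =
    fort-unforced (twins-fort (a≢b ∘ g-injective) same)
      (λ { v∈ (inj₁ refl) → white a v∈ ; v∈ (inj₂ refl) → white b v∈ }) (forcing (g a)) (inj₁ refl)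
  -- Four vertices in pairwise different classes represent all four classes.
  ... | no distinct with injective⇒onto (classAt ∘ g) (λ {a} {b} same →
                           decidable-stable (a ≟ b) λ a≢b → distinct (a , b , a≢b , same))
  ... | onto with onto (suc zero)
  ... | a , ca = fort-unforced (transversal-fort g onto)
    (λ { v∈ ((i , refl) , _) → white i v∈ }) (forcing (g a)) ((a , refl) , λ ca′ → contradiction (trans (sym ca) ca′) λ ())

  lower-bound : ∀ S → IsZeroForcingSet A S → 3 + k ≤ ∣ S ∣
  lower-bound S forcing = decidable-stable (3 + k ≤? ∣ S ∣) λ too-small →
    let g , g-injective , g∈ = members 4 (∁ S) (many-whites (≤-pred (≰⇒> too-small)))
    in few-whites forcing g g-injective (x∈∁p⇒x∉p ∘ g∈)
    where
    many-whites : ∣ S ∣ ≤ 2 + k → 4 ≤ ∣ ∁ S ∣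
    many-whites S≤ = ≤-trans (≤-reflexive (sym (m+n∸n≡m 4 (2 + k))))
      (≤-trans (∸-monoʳ-≤ (6 + k) S≤) (≤-reflexive (sym (∣∁p∣≡n∸∣p∣ S))))

  zeroForcingNumber : ZeroForcingNumberIs A (3 + k)
  zeroForcingNumber with chain⇒zeroForcing A simple (found⇒chain 3 from-induced triStar-found)
  ... | S , forcing , size = (S , forcing , +-cancelˡ-≡ 3 _ _ size) , lower-bound

zeroForcing⇒chain-free : ∀ {A : AdjRel (6 + k)} → IsSimple A → ZeroForcingNumberIs A (3 + k) → ¬ HasChain A 4
zeroForcing⇒chain-free {k} {A} simple (_ , minimal) chain with chain⇒zeroForcing A simple chain
... | S , forcing , size = 1+n≰n (≤-trans (minimal S forcing) (≤-reflexive (+-cancelˡ-≡ 4 _ _ size)))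

theorem5p2 : (n : ℕ) → 6 ≤ n → (A : AdjRel n) → IsSimple A →
    Unicyclic A → Connected (complement A) →
    (ZeroForcingNumberIs A (n ∸ 3) ⇔ Isomorphic A (triStar n))
-- Matching on `6 ≤ n` turns `n` into `6 + k`, so that `n ∸ 3` computes to `3 + k`.
theorem5p2 _ (s≤s (s≤s (s≤s (s≤s (s≤s (s≤s z≤n)))))) A simple (conn , C , unique) co-conn = mk⇔
  (λ Z → chain-free⇒isomorphic A simple C unique conn co-conn (zeroForcing⇒chain-free simple Z))
  (λ (φ , φ-iso) → Converse.zeroForcingNumber A simple φ φ-iso)
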